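{- The random graph is not finite sets interpretable in a tree: there is no tree $t$ and no finite sets interpretation $\mathcal{I}$ such that $\mathcal{I}(t)$ is isomorphic to the random graph.
   Context: The random graph is the (unique up to isomorphism) countable undirected unlabeled graph such that for any two disjoint finite sets $E,F$ of vertices there is a vertex $v$ adjacent to all elements of $E$ and to none of $F$. A tree labeled by a finite alphabet $\Sigma$ is a partial mapping $t:\{0,1\}^*\to\Sigma$ with prefix-closed domain such that $u1\in\mathit{dom}(t)$ implies $u0\in\mathit{dom}(t)$; as a structure it has universe $\mathit{dom}(t)$, binary relations $S_i(u,v)\iff v=ui$ ($i=0,1$) and a unary predicate per letter. WMSO is MSO with set variables ranging over finite sets. A finite sets interpretation is a tuple $(\delta(X),\Psi(X,Y))$ of WMSO formulas with free set variables; $\mathcal{I}(t)$ has vertex set the finite $U\subseteq\mathit{dom}(t)$ with $t\models\delta(U)$ and edge relation $\{(U,V): t\models\Psi(U,V)\}$. -}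

module Defs where

open import Data.Nat using (ℕ)
open import Data.Fin using (Fin; zero; suc)
open import Data.Bool using (Bool; true; false)
open import Data.List using (List; []; _∷_; _++_; [_])
open import Data.List.Membership.Propositional using (_∈_; _∉_)
open import Data.List.Relation.Unary.All using (All)
open import Data.Maybe using (Maybe; just; nothing)
open import Data.Product using (Σ; ∃; _×_; _,_)
open import Data.Empty using (⊥)
open import Relation.Nullary using (¬_)
open import Relation.Binary.PropositionalEquality using (_≡_)

-- Trees labelled by a finite alphabet Fin k.
-- Nodes are words over {0,1}, with 0 = false and 1 = true; the child
-- ui of u is  u ++ [ i ].

Word : Set
Word = List Bool

record Tree (k : ℕ) : Set where
  field
    label        : Word → Maybe (Fin k)
    prefixClosed : ∀ u b a → label (u ++ [ b ]) ≡ just a → ∃ λ a′ → label u ≡ just a′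
    leftSibling  : ∀ u a → label (u ++ [ true ]) ≡ just a → ∃ λ a′ → label (u ++ [ false ]) ≡ just a′

open Tree public

InDom : ∀ {k} → Tree k → Word → Set
InDom t u = ∃ λ a → label t u ≡ just a

FinSub : ∀ {k} → Tree k → Set
FinSub t = Σ (List Word) (All (InDom t))

-- WMSO formulas over the signature (S₀, S₁, P_a (a : Fin k)),
-- with m first-order and n set variables in scope (de Bruijn).

data Formula (k : ℕ) : ℕ → ℕ → Set where
  succ  : ∀ {m n} → Bool → Fin m → Fin m → Formula k m n
  lab   : ∀ {m n} → Fin k → Fin m → Formula k m n
  eq    : ∀ {m n} → Fin m → Fin m → Formula k m n
  mem   : ∀ {m n} → Fin m → Fin n → Formula k m n
  neg   : ∀ {m n} → Formula k m n → Formula k m n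
  and   : ∀ {m n} → Formula k m n → Formula k m n → Formula k m n
  ex₁   : ∀ {m n} → Formula k (ℕ.suc m) n → Formula k m n
  exS   : ∀ {m n} → Formula k m (ℕ.suc n) → Formula k m n

extend : ∀ {l} {A : Set l} {n} → A → (Fin n → A) → Fin (ℕ.suc n) → A
extend a ρ zero    = a
extend a ρ (suc i) = ρ i

Sat : ∀ {k m n} → (t : Tree k) → Formula k m n → (Fin m → Word) → (Fin n → List Word) → Set
Sat t (succ b x y) ρ σ = ρ y ≡ ρ x ++ [ b ]
Sat t (lab a x)    ρ σ = label t (ρ x) ≡ just a
Sat t (eq x y)     ρ σ = ρ x ≡ ρ y
Sat t (mem x X)    ρ σ = ρ x ∈ σ X
Sat t (neg φ)      ρ σ = ¬ Sat t φ ρ σ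
Sat t (and φ ψ)    ρ σ = Sat t φ ρ σ × Sat t ψ ρ σ
Sat t (ex₁ φ)      ρ σ = Σ Word λ u → InDom t u × Sat t φ (extend u ρ) σ
Sat t (exS φ)      ρ σ = Σ (List Word) λ U → All (InDom t) U × Sat t φ ρ (extend U σ)

noFO : Fin 0 → Word
noFO ()

record FSInterp (k : ℕ) : Set where
  field
    δ : Formula k 0 1
    Ψ : Formula k 0 2

open FSInterp public

set1 : List Word → Fin 1 → List Word
set1 U zero = U

set2 : List Word → List Word → Fin 2 → List Word
set2 U V zero          = U
set2 U V (suc zero)    = V

Vertex : ∀ {k} → FSInterp k → Tree k → Set
Vertex I t = Σ (FinSub t) λ U → Sat t (δ I) noFO (set1 (Data.Product.proj₁ U))

carrier : ∀ {k} (I : FSInterp k) (t : Tree k) → Vertex I t → List Word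
carrier I t ((U , _) , _) = U

-- two vertices are the same vertex iff they denote the same finite set
SameSet : List Word → List Word → Set
SameSet U V = (∀ u → u ∈ U → u ∈ V) × (∀ u → u ∈ V → u ∈ U)

EdgeI : ∀ {k} (I : FSInterp k) (t : Tree k) → Vertex I t → Vertex I t → Set
EdgeI I t U V = Sat t (Ψ I) noFO (set2 (carrier I t U) (carrier I t V))

record Graph : Set₁ where
  field
    V     : Set
    E     : V → V → Set
    sym   : ∀ {x y} → E x y → E y x
    irrefl : ∀ {x} → ¬ E x x

open Graph public

Countable : Set → Set
Countable A = Σ (A → ℕ) λ f → ∀ x y → f x ≡ f y → x ≡ y

Disjoint : ∀ {A : Set} → List A → List A → Set
Disjoint Es Fs = ∀ x → x ∈ Es → x ∉ Fs

Extension : Graph → Set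
Extension G = ∀ (Es Fs : List (V G)) → Disjoint Es Fs →
  Σ (V G) λ v → (∀ x → x ∈ Es → E G v x) × (∀ x → x ∈ Fs → ¬ E G v x)

IsRandomGraph : Graph → Set
IsRandomGraph G = Countable (V G) × Extension G

-- I(t) is isomorphic to G (vertices of I(t) taken up to equality of sets)
record IsoToGraph {k} (I : FSInterp k) (t : Tree k) (G : Graph) : Set where
  field
    f        : Vertex I t → V G
    wellDef  : ∀ U W → SameSet (carrier I t U) (carrier I t W) → f U ≡ f W
    inj      : ∀ U W → f U ≡ f W → SameSet (carrier I t U) (carrier I t W)
    surj     : ∀ v → Σ (Vertex I t) λ U → f U ≡ v
    edges⇒   : ∀ U W → EdgeI I t U W → E G (f U) (f W)
    edges⇐   : ∀ U W → E G (f U) (f W) → EdgeI I t U W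

-- Cut the tree at a node u. By Feferman–Vaught composition, Sat of a fixed
-- formula is a union of boundedly many rectangles (condition outside u) ×
-- (condition inside u), so there are boundedly many types. If K vertices differed
-- pairwise both outside and inside u, recombining their parts would give a K × K
-- grid of vertices on which adjacency to any z depends on row type × column type
-- only, contradicting the extension property. It follows that, for some N
-- independent of u, there are no N vertices pairwise different outside u together
-- with N vertices pairwise different inside u. Call u heavy if there are no N
-- vertices pairwise different outside u. The root is heavy and, the graph being
-- infinite, a heavy node has a heavy child; but no node below the depth of N given
-- distinct vertices is heavy. Classical case distinctions are made under ¬ ¬.

module Submission where

open import Defs hiding (sym)
open import Data.Nat using (ℕ; zero; suc; _+_; _*_; _^_; _≤_; _<_; z≤n; s≤s)
open import Data.Nat.Properties using (≤-refl; ≤-trans; ≤-reflexive; +-suc; +-assoc; +-identityʳ;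
  +-cancelˡ-≤; +-monoˡ-≤; n<1+n; n≤1+n; <⇒≱; ≰⇒>; _≤?_; module ≤-Reasoning)
open import Data.Fin using (Fin; zero; suc; punchIn; inject≤; finToFun; funToFin; splitAt; _↑ˡ_;
  _↑ʳ_; remQuot; combine)
open import Data.Fin.Properties using (pigeonhole; finToFun-funToFin; splitAt-↑ˡ; splitAt-↑ʳ;
  remQuot-combine; inject≤-injective; <⇒≢; suc-injective; punchIn-injective; punchInᵢ≢i) renaming
  (_≟_ to _≟ᶠ_)
open import Data.Bool using (Bool; true; false; not) renaming (_≟_ to _≟ᵇ_)
open import Data.List using (List; []; _∷_; _++_; [_]; length; filter; map; lookup; tabulate;
  concat; allFin; cartesianProduct)
open import Data.List.Properties using (length-tabulate; length-++)
open import Data.List.Membership.Propositional using (_∈_)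
open import Data.List.Membership.Propositional.Properties using (∈-filter⁺; ∈-filter⁻; ∈-map⁺;
  ∈-map⁻; ∈-++⁺ˡ; ∈-++⁺ʳ; ∈-++⁻; ∈-cartesianProduct⁺; ∈-allFin; ∈-lookup; ∈-concat⁺′; ∈-tabulate⁺)
open import Data.List.Relation.Unary.All using (All; []; _∷_) renaming (lookup to All-lookup;
  tabulate to All-tabulate)
open import Data.List.Relation.Unary.Any using (here; there)
open import Data.List.Relation.Unary.AllPairs using (AllPairs; []; _∷_) renaming (zip to
  AllPairs-zip)
import Data.List.Relation.Unary.AllPairs.Properties as AllPairs
open import Data.Product using (Σ; ∃; _×_; _,_; proj₁; proj₂; uncurry)
open import Data.Sum using (_⊎_; inj₁; inj₂; [_,_]′)
open import Data.Maybe using (just)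
open import Data.Unit using (⊤; tt)
open import Data.List.Extrema.Nat using (max; xs≤max)
open import Data.Empty using (⊥; ⊥-elim)
open import Function using (_∘_; id; case_of_)
open import Relation.Nullary using (¬_; Dec; yes; no; does; ¬?; ¬¬-excluded-middle)
open import Relation.Binary using (Decidable; Symmetric; Transitive)
open import Relation.Binary.PropositionalEquality using (_≡_; _≢_; refl; sym; trans; cong; subst)

-- Finiteness of the index set lets double negation pass through `∀`. Undecidable cases can thus be
-- settled for all indices at once whenever the goal is a negation.
¬¬-∀ : ∀ {n} {P : Fin n → Set} → (∀ i → ¬ ¬ P i) → ¬ ¬ (∀ i → P i)
¬¬-∀ {zero}  h k = k λ ()
¬¬-∀ {suc n} h k = h zero λ p → ¬¬-∀ (h ∘ suc) λ ps → k λ { zero → p ; (suc i) → ps i }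

-- Assignments seen from one side of a cut, and recombination of finite sets.

Pred : ℕ → ℕ → Set₁
Pred m n = (Fin m → Word) → (Fin n → List Word) → Set

-- Side `b` cannot tell apart two words off that side: it sees only that they are elsewhere.
data SameWord (χ : Word → Bool) (b : Bool) (w w′ : Word) : Set where
  equal : w ≡ w′ → SameWord χ b w w′
  other : χ w ≢ b → χ w′ ≢ b → SameWord χ b w w′

record SameOn (χ : Word → Bool) (b : Bool) (U V : List Word) : Set where
  constructor sameOn
  field at : ∀ w → χ w ≡ b → (w ∈ U → w ∈ V) × (w ∈ V → w ∈ U)

open SameOn

module _ {χ : Word → Bool} {b : Bool} where

  sameWord⇒≡ : ∀ {w w′} → SameWord χ b w w′ → χ w ≡ b → w ≡ w′
  sameWord⇒≡ (equal e)   _ = e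
  sameWord⇒≡ (other n _) p = ⊥-elim (n p)

  sameWord-sym : ∀ {w w′} → SameWord χ b w w′ → SameWord χ b w′ w
  sameWord-sym (equal e)   = equal (sym e)
  sameWord-sym (other p q) = other q p

  sameOn-refl : ∀ {U} → SameOn χ b U U
  sameOn-refl .at w _ = id , id

  sameOn-sym : ∀ {U V} → SameOn χ b U V → SameOn χ b V U
  sameOn-sym s .at w p = proj₂ (at s w p) , proj₁ (at s w p)

  sameOn-trans : ∀ {U V W} → SameOn χ b U V → SameOn χ b V W → SameOn χ b U W
  sameOn-trans s s′ .at w p = proj₁ (at s′ w p) ∘ proj₁ (at s w p) , proj₂ (at s w p) ∘ proj₂ (at s′ w p)

  extend-sameWord : ∀ {m} {w w′} {ρ ρ′ : Fin m → Word} → SameWord χ b w w′ →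
    (∀ i → SameWord χ b (ρ i) (ρ′ i)) → ∀ i → SameWord χ b (extend w ρ i) (extend w′ ρ′ i)
  extend-sameWord s _  zero    = s
  extend-sameWord _ ss (suc i) = ss i

  extend-sameOn : ∀ {n} {U U′} {σ σ′ : Fin n → List Word} → SameOn χ b U U′ →
    (∀ i → SameOn χ b (σ i) (σ′ i)) → ∀ i → SameOn χ b (extend U σ i) (extend U′ σ′ i)
  extend-sameOn s _  zero    = s
  extend-sameOn _ ss (suc i) = ss i

-- Recombination across the cut. It supplies both the witness for a set quantifier and the new
-- vertices of the grid.
merge : (Word → Bool) → List Word → List Word → List Word
merge χ U V = filter (λ w → χ w ≟ᵇ false) U ++ filter (λ w → χ w ≟ᵇ true) V

module _ (χ : Word → Bool) (U V : List Word) where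

  merge-false : SameOn χ false U (merge χ U V)
  merge-false .at w p = (λ i → ∈-++⁺ˡ (∈-filter⁺ (λ w → χ w ≟ᵇ false) i p)) , back
    where
    back : w ∈ merge χ U V → w ∈ U
    back i with ∈-++⁻ (filter (λ w → χ w ≟ᵇ false) U) i
    ... | inj₁ j = proj₁ (∈-filter⁻ (λ w → χ w ≟ᵇ false) j)
    ... | inj₂ j with trans (sym p) (proj₂ (∈-filter⁻ (λ w → χ w ≟ᵇ true) {xs = V} j))
    ...   | ()

  merge-true : SameOn χ true V (merge χ U V)
  merge-true .at w p = (λ i → ∈-++⁺ʳ _ (∈-filter⁺ (λ w → χ w ≟ᵇ true) i p)) , back
    where
    back : w ∈ merge χ U V → w ∈ V
    back i with ∈-++⁻ (filter (λ w → χ w ≟ᵇ false) U) i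
    ... | inj₂ j = proj₁ (∈-filter⁻ (λ w → χ w ≟ᵇ true) j)
    ... | inj₁ j with trans (sym p) (proj₂ (∈-filter⁻ (λ w → χ w ≟ᵇ false) {xs = U} j))
    ...   | ()

  merge-All : {P : Word → Set} → All P U → All P V → All P (merge χ U V)
  merge-All {P} pU pV = All-tabulate λ i → go (∈-++⁻ (filter (λ w → χ w ≟ᵇ false) U) i)
    where
    go : ∀ {w} → w ∈ filter (λ w → χ w ≟ᵇ false) U ⊎ w ∈ filter (λ w → χ w ≟ᵇ true) V → P w
    go (inj₁ j) = All-lookup pU (proj₁ (∈-filter⁻ (λ w → χ w ≟ᵇ false) j))
    go (inj₂ j) = All-lookup pV (proj₁ (∈-filter⁻ (λ w → χ w ≟ᵇ true) j))

-- Unions of rectangles and their closure under the logical connectives.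

-- Classically, φ is a union of c rectangles, each the product of a condition
-- on the χ-false part and a condition on the χ-true part of the assignment.
record Splitting (χ : Word → Bool) {m n} (φ : Pred m n) (c : ℕ) : Set₁ where
  field
    part     : Bool → Fin c → Pred m n
    invar    : ∀ b k {ρ ρ′ σ σ′} → (∀ i → SameWord χ b (ρ i) (ρ′ i)) →
               (∀ i → SameOn χ b (σ i) (σ′ i)) → part b k ρ σ → part b k ρ′ σ′
    sound    : ∀ {k ρ σ} → part false k ρ σ → part true k ρ σ → ¬ ¬ φ ρ σ
    complete : ∀ {ρ σ} → φ ρ σ → ¬ ¬ (∃ λ k → part false k ρ σ × part true k ρ σ)

open Splitting

module _ {χ : Word → Bool} {m n : ℕ} where

  resp-splitting : ∀ {φ ψ : Pred m n} {c} → (∀ {ρ σ} → φ ρ σ → ψ ρ σ) → (∀ {ρ σ} → ψ ρ σ → φ ρ σ) →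
    Splitting χ φ c → Splitting χ ψ c
  resp-splitting to from S .part           = part S
  resp-splitting to from S .invar          = invar S
  resp-splitting to from S .sound p q k    = sound S p q (k ∘ to)
  resp-splitting to from S .complete p     = complete S (from p)

  -- A single rectangle suffices: the guard `b′ ≡ b` makes its factor on the other side vacuous.
  oneSided : ∀ b (P : Pred m n) →
    (∀ {ρ ρ′ σ σ′} → (∀ i → SameWord χ b (ρ i) (ρ′ i)) → (∀ i → SameOn χ b (σ i) (σ′ i)) → P ρ σ → P ρ′ σ′) →
    Splitting χ P 1
  oneSided b P inv .part b′ _ ρ σ            = b′ ≡ b → P ρ σ
  oneSided b P inv .invar b′ _ ss ts p refl  = inv ss ts (p refl)
  oneSided false P inv .sound p _ k          = k (p refl)
  oneSided true  P inv .sound _ p k          = k (p refl)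
  oneSided b P inv .complete p k             = k (zero , (λ _ → p) , λ _ → p)

  or-splitting : ∀ {φ ψ : Pred m n} {c d} → Splitting χ φ c → Splitting χ ψ d →
    Splitting χ (λ ρ σ → φ ρ σ ⊎ ψ ρ σ) (c + d)
  or-splitting {c = c} S T .part b k ρ σ = [ (λ i → part S b i ρ σ) , (λ j → part T b j ρ σ) ]′ (splitAt c k)
  or-splitting {c = c} S T .invar b k ss ts p with splitAt c k
  ... | inj₁ i = invar S b i ss ts p
  ... | inj₂ j = invar T b j ss ts p
  or-splitting {c = c} S T .sound {k} p q r with splitAt c k
  ... | inj₁ i = sound S p q (r ∘ inj₁)
  ... | inj₂ j = sound T p q (r ∘ inj₂)
  or-splitting {c = c} {d} S T .complete {ρ} {σ} (inj₁ p) r = complete S p λ (i , x , y) →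
    r (i ↑ˡ d , subst (λ z → [ _ , (λ j → part T false j ρ σ) ]′ z) (sym (splitAt-↑ˡ c i d)) x
              , subst (λ z → [ _ , (λ j → part T true j ρ σ) ]′ z) (sym (splitAt-↑ˡ c i d)) y)
  or-splitting {c = c} {d} S T .complete {ρ} {σ} (inj₂ p) r = complete T p λ (j , x , y) →
    r (c ↑ʳ j , subst (λ z → [ (λ j → part S false j ρ σ) , _ ]′ z) (sym (splitAt-↑ʳ c d j)) x
              , subst (λ z → [ (λ j → part S true j ρ σ) , _ ]′ z) (sym (splitAt-↑ʳ c d j)) y)

  and-splitting : ∀ {φ ψ : Pred m n} {c d} → Splitting χ φ c → Splitting χ ψ d →
    Splitting χ (λ ρ σ → φ ρ σ × ψ ρ σ) (c * d)
  and-splitting {c = c} {d} S T .part b k ρ σ =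
    part S b (proj₁ (remQuot {c} d k)) ρ σ × part T b (proj₂ (remQuot {c} d k)) ρ σ
  and-splitting S T .invar b k ss ts (p , q) = invar S b _ ss ts p , invar T b _ ss ts q
  and-splitting S T .sound (p , q) (p′ , q′) r = sound S p p′ λ x → sound T q q′ λ y → r (x , y)
  and-splitting {c = c} {d} S T .complete {ρ} {σ} (x , y) r =
    complete S x λ (i , p , p′) → complete T y λ (j , q , q′) →
    r (combine i j , pair false (p , q) , pair true (p′ , q′))
    where
    pair : ∀ b {i j} → part S b i ρ σ × part T b j ρ σ →
      part S b (proj₁ (remQuot {c} d (combine i j))) ρ σ × part T b (proj₂ (remQuot {c} d (combine i j))) ρ σ
    pair b {i} {j} = subst (λ (i , j) → part S b i ρ σ × part T b j ρ σ) (sym (remQuot-combine i j))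

  bit : Bool → Fin 2
  bit false = zero
  bit true  = suc zero

  -- A complement of c rectangles is the union, over all subsets s of them, of
  -- (no false part in s holds) × (no true part outside s holds).
  neg-splitting : ∀ {φ : Pred m n} {c} → Splitting χ φ c → Splitting χ (λ ρ σ → ¬ φ ρ σ) (2 ^ c)
  neg-splitting S .part b j ρ σ = ∀ k → finToFun j k ≡ bit b → ¬ part S b k ρ σ
  neg-splitting S .invar b j ss ts h k e p =
    h k e (invar S b k (λ i → sameWord-sym (ss i)) (λ i → sameOn-sym (ts i)) p)
  neg-splitting S .sound {j} h h′ r = r λ x → complete S x λ (k , p , q) → contra k p q
    where
    contra : ∀ k → part S false k _ _ → part S true k _ _ → ⊥
    contra k p q with finToFun j k in e
    ... | zero     = h k e p
    ... | suc zero = h′ k e q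
  neg-splitting {c = c} S .complete {ρ} {σ} ¬φ r =
    ¬¬-∀ {P = λ k → Dec (part S false k ρ σ)} (λ k → ¬¬-excluded-middle) λ dec →
    -- The subset consists of the rectangles whose false part fails. Wherever the false part holds,
    -- the true part must fail, since otherwise φ would hold.
    r (funToFin (bit ∘ does ∘ dec) , isFalse dec , isTrue dec)
    where
    isFalse : (dec : ∀ k → Dec (part S false k ρ σ)) →
      ∀ k → finToFun (funToFin (bit ∘ does ∘ dec)) k ≡ bit false → ¬ part S false k ρ σ
    isFalse dec k e p with dec k | trans (sym (finToFun-funToFin (bit ∘ does ∘ dec) k)) e
    ... | no ¬p | _ = ¬p p
    isTrue : (dec : ∀ k → Dec (part S false k ρ σ)) →
      ∀ k → finToFun (funToFin (bit ∘ does ∘ dec)) k ≡ bit true → ¬ part S true k ρ σ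
    isTrue dec k e q with dec k | trans (sym (finToFun-funToFin (bit ∘ does ∘ dec) k)) e
    ... | yes p | _ = sound S p q ¬φ

  -- The two factors may offer different witnesses. Both lie on side `b`, so the factor of the
  -- opposite side does not notice when its witness is replaced by the other one.
  ex₁-splitting : ∀ {φ : Pred (suc m) n} {c} (D : Word → Set) b → Splitting χ φ c →
    Splitting χ (λ ρ σ → Σ Word λ w → χ w ≡ b × D w × φ (extend w ρ) σ) c
  ex₁-splitting D s S .part b k ρ σ = Σ Word λ w → χ w ≡ s × D w × part S b k (extend w ρ) σ
  ex₁-splitting D s S .invar b k ss ts (w , e , d , p) =
    w , e , d , invar S b k (extend-sameWord (equal refl) ss) ts p
  ex₁-splitting D false S .sound (w , e , d , p) (w′ , e′ , d′ , q) r =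
    sound S p (invar S true _ (extend-sameWord (other (differ e′) (differ e)) λ i → equal refl) (λ i → sameOn-refl) q)
      λ x → r (w , e , d , x)
    where
    differ : ∀ {a} → a ≡ false → a ≢ true
    differ refl ()
  ex₁-splitting D true S .sound (w , e , d , p) (w′ , e′ , d′ , q) r =
    sound S (invar S false _ (extend-sameWord (other (differ e) (differ e′)) λ i → equal refl) (λ i → sameOn-refl) p) q
      λ x → r (w′ , e′ , d′ , x)
    where
    differ : ∀ {a} → a ≡ true → a ≢ false
    differ refl ()
  ex₁-splitting D s S .complete (w , e , d , x) r =
    complete S x λ (k , p , q) → r (k , (w , e , d , p) , (w , e , d , q))

  -- The sets offered by the two factors are merged; the result agrees with each of them on the side
  -- where it matters.
  exS-splitting : ∀ {φ : Pred m (suc n)} {c} (D : Word → Set) → Splitting χ φ c →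
    Splitting χ (λ ρ σ → Σ (List Word) λ U → All D U × φ ρ (extend U σ)) c
  exS-splitting D S .part b k ρ σ = Σ (List Word) λ U → All D U × part S b k ρ (extend U σ)
  exS-splitting D S .invar b k ss ts (U , d , p) = U , d , invar S b k ss (extend-sameOn sameOn-refl ts) p
  exS-splitting D S .sound (U , d , p) (V , e , q) r =
    sound S (invar S false _ (λ i → equal refl) (extend-sameOn (merge-false χ U V) λ i → sameOn-refl) p)
            (invar S true _ (λ i → equal refl) (extend-sameOn (merge-true χ U V) λ i → sameOn-refl) q)
      λ x → r (merge χ U V , merge-All χ U V d e , x)
  exS-splitting D S .complete (U , d , x) r = complete S x λ (k , p , q) → r (k , (U , d , p) , (U , d , q))

-- The cut at a node `u`: words having `u` as a prefix against all others.

inside : Word → Word → Bool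
inside []       w       = true
inside (x ∷ u)  []      = false
inside (x ∷ u)  (y ∷ w) with x ≟ᵇ y
... | yes _ = inside u w
... | no  _ = false

-- Appending a letter crosses the cut only along the edge that enters `u` from its parent.
inside-∷ʳ : ∀ u w b → inside u (w ++ [ b ]) ≡ inside u w ⊎ w ++ [ b ] ≡ u
inside-∷ʳ []      w       b = inj₁ refl
inside-∷ʳ (x ∷ u) []      b with x ≟ᵇ b
inside-∷ʳ (x ∷ [])    [] b | yes refl = inj₂ refl
inside-∷ʳ (x ∷ y ∷ u) [] b | yes refl = inj₁ refl
... | no _ = inj₁ refl
inside-∷ʳ (x ∷ u) (y ∷ w) b with x ≟ᵇ y
... | no _ = inj₁ refl
... | yes refl with inside-∷ʳ u w b
...   | inj₁ e = inj₁ e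
...   | inj₂ e = inj₂ (cong (x ∷_) e)

inside-self : ∀ u → inside u u ≡ true
inside-self []          = refl
inside-self (false ∷ u) = inside-self u
inside-self (true  ∷ u) = inside-self u

inside-length : ∀ u w → inside u w ≡ true → length u ≤ length w
inside-length []      w       _ = z≤n
inside-length (x ∷ u) (y ∷ w) e with x ≟ᵇ y
... | yes _ = s≤s (inside-length u w e)

inside-cases : ∀ u w → inside u w ≡ true → w ≡ u ⊎ (∃ λ b → inside (u ++ [ b ]) w ≡ true)
inside-cases []      []      _ = inj₁ refl
inside-cases []      (y ∷ w) _ = inj₂ (y , self y)
  where
  self : ∀ y → inside [ y ] (y ∷ w) ≡ true
  self false = refl
  self true  = refl
inside-cases (x ∷ u) (y ∷ w) e with x ≟ᵇ y
... | yes refl with inside-cases u w e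
...   | inj₁ e′       = inj₁ (cong (x ∷_) e′)
...   | inj₂ (b , e′) = inj₂ (b , e′)

-- Feferman-Vaught composition for WMSO formulas.

-- The number of rectangles, written in the shape in which the splittings are built. The doubling at
-- `ex₁` accounts for the two sides on which a witness may lie.
rank : ∀ {k m n} → Formula k m n → ℕ
rank (succ b x y) = (1 + 1) + 1 * 1
rank (lab a x)    = 1 + 1
rank (eq x y)     = 1 + 1
rank (mem x X)    = 1 + 1
rank (neg φ)      = 2 ^ rank φ
rank (and φ ψ)    = rank φ * rank ψ
rank (ex₁ φ)      = rank φ + rank φ
rank (exS φ)      = rank φ

module _ {χ : Word → Bool} {m n : ℕ} where

  -- Once the side of `x` is fixed, the atom is decided on that side alone; this gives one rectangle
  -- per side.
  local-splitting : (x : Fin m) (P : Pred m n) →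
    (∀ b {ρ ρ′ σ σ′} → χ (ρ x) ≡ b → (∀ i → SameWord χ b (ρ i) (ρ′ i)) → (∀ i → SameOn χ b (σ i) (σ′ i)) →
      P ρ σ → P ρ′ σ′) →
    Splitting χ P (1 + 1)
  local-splitting x P inv = resp-splitting [ proj₂ , proj₂ ]′ from
    (or-splitting (oneSided false _ (invariant false)) (oneSided true _ (invariant true)))
    where
    invariant : ∀ b {ρ ρ′ : Fin m → Word} {σ σ′ : Fin n → List Word} →
      (∀ i → SameWord χ b (ρ i) (ρ′ i)) → (∀ i → SameOn χ b (σ i) (σ′ i)) →
      χ (ρ x) ≡ b × P ρ σ → χ (ρ′ x) ≡ b × P ρ′ σ′
    invariant b {ρ} {ρ′} {σ} {σ′} ss ts (e , p) =
      subst (λ w → χ w ≡ b) (sameWord⇒≡ (ss x) e) e , inv b {ρ} {ρ′} {σ} {σ′} e ss ts p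
    from : ∀ {ρ σ} → P ρ σ → (χ (ρ x) ≡ false × P ρ σ) ⊎ (χ (ρ x) ≡ true × P ρ σ)
    from {ρ} p with χ (ρ x)
    ... | false = inj₁ (refl , p)
    ... | true  = inj₂ (refl , p)

module _ (u : Word) where

  private
    χ = inside u

  -- Either both nodes lie on one side, or the edge is the one entering `u`. In the latter case
  -- `ρ x ++ [ b ] ≡ u` and `ρ y ≡ u` are conditions on separate sides, so their conjunction is a
  -- rectangle.
  succ-splitting : ∀ {m n} b (x y : Fin m) → Splitting χ {m} {n} (λ ρ σ → ρ y ≡ ρ x ++ [ b ]) ((1 + 1) + 1 * 1)
  succ-splitting {m} {n} b x y = resp-splitting (λ {ρ} {σ} → to {ρ} {σ}) (λ {ρ} {σ} → from {ρ} {σ})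
    (or-splitting (or-splitting (oneSided false (SameSide false) (sameSide false)) (oneSided true (SameSide true) (sameSide true)))
                  (and-splitting (oneSided false Above above) (oneSided true Below below)))
    where
    SameSide : Bool → Pred m n
    SameSide s ρ σ = χ (ρ x) ≡ s × χ (ρ y) ≡ s × ρ y ≡ ρ x ++ [ b ]
    Above Below : Pred m n
    Above ρ σ = χ (ρ x) ≡ false × ρ x ++ [ b ] ≡ u
    Below ρ σ = χ (ρ y) ≡ true × ρ y ≡ u
    sameSide : ∀ s {ρ ρ′ : Fin m → Word} {σ σ′ : Fin n → List Word} →
      (∀ i → SameWord χ s (ρ i) (ρ′ i)) → (∀ i → SameOn χ s (σ i) (σ′ i)) → SameSide s ρ σ → SameSide s ρ′ σ′
    sameSide s ss _ (p , q , e) rewrite sym (sameWord⇒≡ (ss x) p) | sym (sameWord⇒≡ (ss y) q) = p , q , e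
    above : ∀ {ρ ρ′ : Fin m → Word} {σ σ′ : Fin n → List Word} →
      (∀ i → SameWord χ false (ρ i) (ρ′ i)) → (∀ i → SameOn χ false (σ i) (σ′ i)) → Above ρ σ → Above ρ′ σ′
    above ss _ (p , e) rewrite sym (sameWord⇒≡ (ss x) p) = p , e
    below : ∀ {ρ ρ′ : Fin m → Word} {σ σ′ : Fin n → List Word} →
      (∀ i → SameWord χ true (ρ i) (ρ′ i)) → (∀ i → SameOn χ true (σ i) (σ′ i)) → Below ρ σ → Below ρ′ σ′
    below ss _ (p , e) rewrite sym (sameWord⇒≡ (ss y) p) = p , e
    to : ∀ {ρ σ} → (SameSide false ρ σ ⊎ SameSide true ρ σ) ⊎ (Above ρ σ × Below ρ σ) → ρ y ≡ ρ x ++ [ b ]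
    to (inj₁ (inj₁ (_ , _ , e)))       = e
    to (inj₁ (inj₂ (_ , _ , e)))       = e
    to (inj₂ ((_ , e) , (_ , e′)))     = trans e′ (sym e)
    cases : ∀ {ρ σ} s s′ → χ (ρ x) ≡ s → χ (ρ x ++ [ b ]) ≡ s′ → ρ y ≡ ρ x ++ [ b ] →
      χ (ρ x ++ [ b ]) ≡ χ (ρ x) ⊎ ρ x ++ [ b ] ≡ u →
      (SameSide false ρ σ ⊎ SameSide true ρ σ) ⊎ (Above ρ σ × Below ρ σ)
    cases false false p q e _ = inj₁ (inj₁ (p , trans (cong χ e) q , e))
    cases true  true  p q e _ = inj₁ (inj₂ (p , trans (cong χ e) q , e))
    cases false true  p q e (inj₂ r) = inj₂ ((p , r) , (trans (cong χ e) q , trans e r))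
    cases false true  p q e (inj₁ r) with trans (sym q) (trans r p)
    ... | ()
    cases true  false p q e (inj₁ r) with trans (sym p) (trans (sym r) q)
    ... | ()
    cases {ρ} true false p q e (inj₂ r) with trans (sym q) (trans (cong χ r) (inside-self u))
    ... | ()
    from : ∀ {ρ σ} → ρ y ≡ ρ x ++ [ b ] →
      (SameSide false ρ σ ⊎ SameSide true ρ σ) ⊎ (Above ρ σ × Below ρ σ)
    from {ρ} {σ} e = cases {ρ} {σ} _ _ refl refl e (inside-∷ʳ u (ρ x) b)

  -- Feferman–Vaught composition: the number of rectangles depends on the
  -- formula only, not on the tree or on the node at which it is cut.
  splitting : ∀ {k m n} (t : Tree k) (φ : Formula k m n) → Splitting χ (Sat t φ) (rank φ)
  splitting t (succ b x y) = succ-splitting b x y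
  splitting t (lab a x)    = local-splitting x _ λ b e ss _ → subst (λ w → label t w ≡ just a) (sameWord⇒≡ (ss x) e)
  splitting t (eq x y)     = local-splitting x _ λ b e ss _ p →
    trans (sym (sameWord⇒≡ (ss x) e)) (trans p (sameWord⇒≡ (ss y) (subst (λ w → χ w ≡ b) p e)))
  splitting t (mem x X)    = local-splitting x _ λ b {ρ} {ρ′} {σ} {σ′} e ss ts p →
    subst (_∈ σ′ X) (sameWord⇒≡ (ss x) e) (proj₁ (at (ts X) (ρ x) e) p)
  splitting t (neg φ)      = neg-splitting (splitting t φ)
  splitting t (and φ ψ)    = and-splitting (splitting t φ) (splitting t ψ)
  splitting t (ex₁ φ)      = resp-splitting to from
    (or-splitting (ex₁-splitting (InDom t) false (splitting t φ)) (ex₁-splitting (InDom t) true (splitting t φ)))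
    where
    Ex : Bool → Pred _ _
    Ex b ρ σ = Σ Word λ w → χ w ≡ b × InDom t w × Sat t φ (extend w ρ) σ
    to : ∀ {ρ σ} → Ex false ρ σ ⊎ Ex true ρ σ → Sat t (ex₁ φ) ρ σ
    to (inj₁ (w , _ , p)) = w , p
    to (inj₂ (w , _ , p)) = w , p
    from : ∀ {ρ σ} → Sat t (ex₁ φ) ρ σ → Ex false ρ σ ⊎ Ex true ρ σ
    from (w , p) with χ w in e
    ... | false = inj₁ (w , e , p)
    ... | true  = inj₂ (w , e , p)
  splitting t (exS φ)      = exS-splitting (InDom t) (splitting t φ)

-- Extracting uniform subfamilies from finite families.

lookup-pairs : ∀ {A : Set} {T : A → A → Set} {xs : List A} → Symmetric T → AllPairs T xs →
  ∀ i j → i ≢ j → T (lookup xs i) (lookup xs j)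
lookup-pairs sy (p ∷ ps) zero    zero    n = ⊥-elim (n refl)
lookup-pairs sy (p ∷ ps) zero    (suc j) n = All-lookup p (∈-lookup j)
lookup-pairs sy (p ∷ ps) (suc i) zero    n = sy (All-lookup p (∈-lookup i))
lookup-pairs sy (p ∷ ps) (suc i) (suc j) n = lookup-pairs sy ps i j (n ∘ cong suc)

length-filter-¬ : ∀ {A : Set} {P : A → Set} (P? : ∀ a → Dec (P a)) xs →
  length (filter P? xs) + length (filter (¬? ∘ P?) xs) ≡ length xs
length-filter-¬ P? []       = refl
length-filter-¬ P? (x ∷ xs) with P? x
... | yes _ = cong suc (length-filter-¬ P? xs)
... | no  _ = trans (+-suc _ _) (cong suc (length-filter-¬ P? xs))

module _ {A : Set} {R : A → A → Set} (R? : Decidable R) (R-sym : Symmetric R) (R-trans : Transitive R) where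

  -- Greedy choice: if `x` together with its `R`-relatives numbers at least `K`, these form the
  -- second outcome. Otherwise fewer than `K` entries are discarded, `x` is kept, and the rest is
  -- treated recursively. `S` carries along a relation known beforehand, such as distinctness.
  list-dichotomy : ∀ {S : A → A → Set} N K (xs : List A) → N * K ≤ length xs → AllPairs S xs →
    (∃ λ ys → N ≤ length ys × (∀ {y} → y ∈ ys → y ∈ xs) × AllPairs (λ x y → S x y × ¬ R x y) ys) ⊎
    (∃ λ ys → K ≤ length ys × AllPairs (λ x y → S x y × R x y) ys)
  list-dichotomy zero    K       xs       l ps = inj₁ ([] , z≤n , (λ ()) , [])
  list-dichotomy (suc N) zero    xs       l ps = inj₂ ([] , z≤n , [])
  list-dichotomy {S} (suc N) K@(suc _) (x ∷ xs) l (p ∷ ps) with K ≤? suc (length (filter (R? x) xs))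
  ... | yes K≤ = inj₂ (x ∷ near , K≤ , All-tabulate (λ i → All-lookup p (proj₁ (∈-filter⁻ (R? x) i)) , xR i)
                 ∷ AllPairs-zip (AllPairs.filter⁺ (R? x) ps , pairwise near xR))
    where
    near = filter (R? x) xs
    xR : ∀ {y} → y ∈ near → R x y
    xR i = proj₂ (∈-filter⁻ (R? x) {xs = xs} i)
    pairwise : ∀ ys → (∀ {y} → y ∈ ys → R x y) → AllPairs R ys
    pairwise []       h = []
    pairwise (y ∷ ys) h =
      All-tabulate (λ i → R-trans (R-sym (h (here refl))) (h (there i))) ∷ pairwise ys (h ∘ there)
  ... | no K≰ with list-dichotomy {S} N K (filter (¬? ∘ R? x) xs) enough (AllPairs.filter⁺ (¬? ∘ R? x) ps)
    where
    a = length (filter (R? x) xs)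
    b = length (filter (¬? ∘ R? x) xs)
    enough : N * K ≤ b
    enough = +-cancelˡ-≤ (suc a) _ _ (begin
      suc a + N * K ≤⟨ +-monoˡ-≤ (N * K) (≤-trans (n≤1+n _) (≰⇒> K≰)) ⟩
      K + N * K     ≤⟨ l ⟩
      suc (length xs) ≡⟨ cong suc (sym (length-filter-¬ (R? x) xs)) ⟩
      suc a + b     ∎)
      where open ≤-Reasoning
  ...   | inj₂ r = inj₂ r
  ...   | inj₁ (ys , N≤ , sub , qs) = inj₁ (x ∷ ys , s≤s N≤ , sub′ ,
          All-tabulate (λ i → All-lookup p (proj₁ (far i)) , proj₂ (far i)) ∷ qs)
    where
    far : ∀ {y} → y ∈ ys → y ∈ xs × ¬ R x y
    far i = ∈-filter⁻ (¬? ∘ R? x) (sub i)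
    sub′ : ∀ {y} → y ∈ x ∷ ys → y ∈ x ∷ xs
    sub′ (here e)  = here e
    sub′ (there i) = there (proj₁ (far i))

Subfamily : ∀ {n} → (Fin n → Fin n → Set) → ℕ → Set
Subfamily {n} R K = Σ (Fin K → Fin n) λ g → ∀ i j → i ≢ j → g i ≢ g j × R (g i) (g j)

list⇒subfamily : ∀ {n K} {R : Fin n → Fin n → Set} → Symmetric R → (xs : List (Fin n)) → K ≤ length xs →
  AllPairs (λ i j → i ≢ j × R i j) xs → Subfamily R K
list⇒subfamily R-sym xs l ps =
  (λ i → lookup xs (inject≤ i l)) ,
  λ i j n → lookup-pairs (λ (p , q) → p ∘ sym , R-sym q) ps _ _ (n ∘ inject≤-injective l l i j)

dichotomy : ∀ {n} {R : Fin n → Fin n → Set} → Symmetric R → Transitive R → ∀ N K → N * K ≤ n →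
  ¬ ¬ (Subfamily (λ i j → ¬ R i j) N ⊎ Subfamily R K)
dichotomy {n} {R} R-sym R-trans N K l r =
  ¬¬-∀ {P = λ i → ∀ j → Dec (R i j)} (λ i → ¬¬-∀ λ j → ¬¬-excluded-middle) λ R? → r (from (
    list-dichotomy R? R-sym R-trans N K (allFin n) (≤-trans l (≤-reflexive (sym (length-tabulate id)))) (AllPairs.tabulate⁺ id)))
  where
  from : ∀ {xs} → (∃ λ ys → N ≤ length ys × (∀ {y} → y ∈ ys → y ∈ xs) × AllPairs (λ x y → x ≢ y × ¬ R x y) ys) ⊎
    (∃ λ ys → K ≤ length ys × AllPairs (λ x y → x ≢ y × R x y) ys) →
    Subfamily (λ i j → ¬ R i j) N ⊎ Subfamily R K
  from (inj₁ (ys , l , _ , ps)) = inj₁ (list⇒subfamily (λ n → n ∘ R-sym) ys l ps)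
  from (inj₂ (ys , l , ps))     = inj₂ (list⇒subfamily R-sym ys l ps)

AgreeOn : ∀ {c} {A : Set} → (Fin c → A → Set) → A → A → Set
AgreeOn P a b = ∀ k → (P k a → P k b) × (P k b → P k a)

-- Each index is coloured by the set of predicates it satisfies. With `2 ^ c` colours there are no
-- `suc (2 ^ c)` indices of pairwise different colours, so the dichotomy yields `K` of one colour.
agreeing : ∀ {n} c (P : Fin c → Fin n → Set) K → suc (2 ^ c) * K ≤ n → ¬ ¬ Subfamily (AgreeOn P) K
agreeing {n} c P K l r =
  ¬¬-∀ {P = λ k → ∀ i → Dec (P k i)} (λ k → ¬¬-∀ λ i → ¬¬-excluded-middle) λ P? →
  dichotomy {R = λ i j → colour P? i ≡ colour P? j} sym trans (suc (2 ^ c)) K l λ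
    { (inj₁ (g , h)) → let (i , j , i<j , e) = pigeonhole (n<1+n (2 ^ c)) (colour P? ∘ g) in
                       proj₂ (h i j (<⇒≢ i<j)) e
    ; (inj₂ (g , h)) → r (g , λ i j n → proj₁ (h i j n) , agree P? (proj₂ (h i j n))) }
  where
  bitOf : ∀ {A : Set} → Dec A → Fin 2
  bitOf (yes _) = suc zero
  bitOf (no  _) = zero
  colour : (∀ k i → Dec (P k i)) → Fin n → Fin (2 ^ c)
  colour P? i = funToFin λ k → bitOf (P? k i)
  transfer : ∀ {A B : Set} (A? : Dec A) (B? : Dec B) → bitOf A? ≡ bitOf B? → (A → B) × (B → A)
  transfer (yes a) (yes b) _ = (λ _ → b) , (λ _ → a)
  transfer (no ¬a) (no ¬b) _ = (λ a → ⊥-elim (¬a a)) , (λ b → ⊥-elim (¬b b))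
  agree : ∀ P? {i j} → colour P? i ≡ colour P? j → AgreeOn P i j
  agree P? {i} {j} e k = transfer (P? k i) (P? k j)
    (trans (sym (finToFun-funToFin (λ k → bitOf (P? k i)) k))
      (trans (cong (λ z → finToFun z k) e) (finToFun-funToFin (λ k → bitOf (P? k j)) k)))

-- The extension property inside the interpreted graph.

module _ {k : ℕ} (t : Tree k) (I : FSInterp k) (G : Graph) (extension : Extension G) (iso : IsoToGraph I t G) where

  open IsoToGraph iso

  private
    X : Set
    X = Vertex I t

    ⟦_⟧ : X → List Word
    ⟦_⟧ = carrier I t

    Adj : X → X → Set
    Adj = EdgeI I t

    c d : ℕ
    c = rank (Ψ I)
    d = rank (δ I)

  -- Abstract, since unfolding these products in conversion checks is very slow.
  abstract
    -- `K₁` forces two rows of equal type, `K₂` leaves `K₁` vertices of equal domain type, `T`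
    -- leaves `K₂` after types are equalised twice, and `N` leaves a star of `T + 2` vertices.
    K₁ K₂ T N : ℕ
    K₁ = suc (2 ^ c) * 2
    K₂ = suc (2 ^ d) * K₁
    T  = suc (2 ^ c) * (suc (2 ^ c) * K₂)
    N  = K₂ * suc (suc T)

    K₁-large : suc (2 ^ c) * 2 ≤ K₁
    K₁-large = ≤-refl

    K₂-large : suc (2 ^ d) * K₁ ≤ K₂
    K₂-large = ≤-refl

    T-large : suc (2 ^ c) * (suc (2 ^ c) * K₂) ≤ suc T
    T-large = n≤1+n _

    N-large : K₂ * suc (suc T) ≤ N
    N-large = ≤-refl

    2≤N : 2 ≤ N
    2≤N = s≤s (s≤s z≤n)

  Same : X → X → Set
  Same x y = SameSet ⟦ x ⟧ ⟦ y ⟧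

  -- The extension property pulled back along the isomorphism. Only entries on opposite sides of `C`
  -- need to differ; repetitions within one side are harmless.
  separate : ∀ {p q} (x : Fin p → Fin q → X) {C : Fin p → Fin q → Set} (C? : ∀ i j → Dec (C i j)) →
    (∀ {i j i′ j′} → C i j → ¬ C i′ j′ → ¬ Same (x i j) (x i′ j′)) →
    Σ X λ y → ∀ i j → (C i j → Adj y (x i j)) × (¬ C i j → ¬ Adj y (x i j))
  separate {p} {q} x {C} C? apart with extension (map fx (filter C?′ ij)) (map fx (filter (¬? ∘ C?′) ij)) disjoint
    where
    ij = cartesianProduct (allFin p) (allFin q)
    fx : Fin p × Fin q → V G
    fx (i , j) = f (x i j)
    C?′ : ∀ ij → Dec (uncurry C ij)
    C?′ (i , j) = C? i j
    disjoint : Disjoint (map fx (filter C?′ ij)) (map fx (filter (¬? ∘ C?′) ij))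
    disjoint v v∈ v∈′ with ∈-map⁻ fx v∈ | ∈-map⁻ fx v∈′
    ... | a , a∈ , e | a′ , a′∈ , e′ =
      apart (proj₂ (∈-filter⁻ C?′ {xs = ij} a∈)) (proj₂ (∈-filter⁻ (¬? ∘ C?′) {xs = ij} a′∈))
        (inj _ _ (trans (sym e) e′))
  ... | v , v-adj , v-nonadj with surj v
  ...   | y , refl = y , λ i j →
      (λ h → edges⇐ _ _ (v-adj _ (∈-map⁺ _ (∈-filter⁺ _ (∈-cartesianProduct⁺ (∈-allFin i) (∈-allFin j)) h)))) ,
      (λ h e → v-nonadj _ (∈-map⁺ _ (∈-filter⁺ _ (∈-cartesianProduct⁺ (∈-allFin i) (∈-allFin j)) h)) (edges⇒ _ _ e))

  adj⇒¬same : ∀ {x y} → Adj x y → ¬ Same x y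
  adj⇒¬same {x} {y} e s = irrefl G (subst (λ v → E G v (f y)) (wellDef x y s) (edges⇒ x y e))

  -- A vertex adjacent to all earlier ones is new, because there are no loops.
  distinctVertices : ∀ n → Σ (Fin n → X) λ x → ∀ i j → i ≢ j → ¬ Same (x i) (x j)
  distinctVertices zero = (λ ()) , λ ()
  distinctVertices (suc n) with distinctVertices n
  ... | x , apart with separate {q = 1} (λ i _ → x i) {λ _ _ → ⊤} (λ _ _ → yes tt) (λ _ n → ⊥-elim (n tt))
  ...   | y , y-adj = x′ , apart′
    where
    y≁x : ∀ i → ¬ Same y (x i)
    y≁x i = adj⇒¬same {y} {x i} (proj₁ (y-adj i zero) tt)
    x′ : Fin (suc n) → X
    x′ zero    = y
    x′ (suc i) = x i
    apart′ : ∀ i j → i ≢ j → ¬ Same (x′ i) (x′ j)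
    apart′ zero    zero    n = ⊥-elim (n refl)
    apart′ zero    (suc j) n = y≁x j
    apart′ (suc i) zero    n = λ (p , q) → y≁x i (q , p)
    apart′ (suc i) (suc j) n = apart i j (n ∘ cong suc)

  -- Vertices compared across a fixed cut.

  module _ (u : Word) where

    private
      χ = inside u

    Alike : Bool → X → X → Set
    Alike b x y = SameOn χ b ⟦ x ⟧ ⟦ y ⟧

    Distinct : Bool → ℕ → Set
    Distinct b n = Σ (Fin n → X) λ x → ∀ i j → i ≢ j → ¬ Alike b (x i) (x j)

    alike⇒same : ∀ {U V} → (∀ b → SameOn χ b U V) → SameSet U V
    alike⇒same a = (λ w → proj₁ (at (a (χ w)) w refl)) , (λ w → proj₂ (at (a (χ w)) w refl))

    same⇒alike : ∀ {U V} → SameSet U V → ∀ b → SameOn χ b U V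
    same⇒alike (p , q) b .at w _ = p w , q w

    domPart : Bool → Fin d → List Word → Set
    domPart b k U = part (splitting u t (δ I)) b k noFO (set1 U)

    domPart-inv : ∀ b k {U V} → SameOn χ b U V → domPart b k U → domPart b k V
    domPart-inv b k s = invar (splitting u t (δ I)) b k (λ ()) λ { zero → s }

    edgePart : Bool → Fin c → List Word → List Word → Set
    edgePart b k U V = part (splitting u t (Ψ I)) b k noFO (set2 U V)

    edgePart-inv : ∀ b k {U U′ V V′} → SameOn χ b U U′ → SameOn χ b V V′ → edgePart b k U V → edgePart b k U′ V′
    edgePart-inv b k s s′ = invar (splitting u t (Ψ I)) b k (λ ()) λ { zero → s ; (suc zero) → s′ }

    adj-transfer : ∀ {x y x′ y′} → (∀ b k → edgePart b k ⟦ x ⟧ ⟦ y ⟧ → edgePart b k ⟦ x′ ⟧ ⟦ y′ ⟧) →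
      Adj x y → ¬ ¬ Adj x′ y′
    adj-transfer h e r = complete (splitting u t (Ψ I)) e λ (k , p , q) →
      sound (splitting u t (Ψ I)) (h false k p) (h true k q) r

    -- The K₁² recombinations x s r of the parts of the y s are vertices. A vertex z
    -- adjacent to x s s only, in each row s, would give distinct rows distinct types.
    no-rectangle : (y : Fin K₁ → X) → (∀ i j → i ≢ j → ∀ b → ¬ Alike b (y i) (y j)) →
      (∀ i j k → domPart false k ⟦ y i ⟧ → domPart false k ⟦ y j ⟧) → ⊥
    no-rectangle y apart agree =
      ¬¬-∀ {P = λ s → ∀ r → Sat t (δ I) noFO (set1 (xᵁ s r))} (λ s → ¬¬-∀ λ r → isVertex s r) λ sat →
      contra (λ s r → (xᵁ s r , merge-All χ _ _ (proj₂ (proj₁ (y s))) (proj₂ (proj₁ (y r)))) , sat s r)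
        (λ s r → merge-false χ ⟦ y s ⟧ ⟦ y r ⟧) (λ s r → merge-true χ ⟦ y s ⟧ ⟦ y r ⟧)
      where
      xᵁ : Fin K₁ → Fin K₁ → List Word
      xᵁ s r = merge χ ⟦ y s ⟧ ⟦ y r ⟧
      isVertex : ∀ s r → ¬ ¬ Sat t (δ I) noFO (set1 (xᵁ s r))
      isVertex s r n = complete (splitting u t (δ I)) (proj₂ (y r)) λ (k , p , q) →
        sound (splitting u t (δ I)) (domPart-inv false k (merge-false χ ⟦ y s ⟧ ⟦ y r ⟧) (agree r s k p))
          (domPart-inv true k (merge-true χ ⟦ y s ⟧ ⟦ y r ⟧) q) n
      contra : (x : Fin K₁ → Fin K₁ → X) → (∀ s r → Alike false (y s) (x s r)) →
        (∀ s r → Alike true (y r) (x s r)) → ⊥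
      contra x out inn with separate x _≟ᶠ_ offDiagonal
        where
        offDiagonal : ∀ {i j i′ j′} → i ≡ j → i′ ≢ j′ → ¬ Same (x i j) (x i′ j′)
        offDiagonal {i} {i′ = i′} {j′} refl n s with i ≟ᶠ i′
        ... | no m     = apart i i′ m false
          (sameOn-trans (out i i) (sameOn-trans (same⇒alike s false) (sameOn-sym (out i′ j′))))
        ... | yes refl = apart i j′ n true
          (sameOn-trans (inn i i) (sameOn-trans (same⇒alike s true) (sameOn-sym (inn i j′))))
      -- Two rows `s` and `r` get the same outside type towards `z`. The vertex `x r s` has the
      -- outside part of row `r` and the inside part of `x s s`, so `z` is adjacent to it although
      -- it is off the diagonal.
      ... | z , z-adj = agreeing c (λ k s → edgePart false k ⟦ z ⟧ ⟦ x s s ⟧) 2 K₁-large λ (g , h) →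
        let s = g zero ; r = g (suc zero) ; (s≢r , same) = h zero (suc zero) (λ ()) in
        adj-transfer {z} {x s s} {z} {x r s}
          (λ { false k p → edgePart-inv false k sameOn-refl (sameOn-trans (sameOn-sym (out r r)) (out r s))
                             (proj₁ (same k) p)
             ; true  k p → edgePart-inv true k sameOn-refl (sameOn-trans (sameOn-sym (inn s s)) (inn r s)) p })
          (proj₁ (z-adj s s) refl) (proj₂ (z-adj r s) (s≢r ∘ sym))

    -- Passing to vertices of equal outside type for `δ` ensures that exchanging outside parts keeps
    -- `δ` true, as the grid requires.
    no-matching : (y : Fin K₂ → X) → (∀ i j → i ≢ j → ∀ b → ¬ Alike b (y i) (y j)) → ⊥
    no-matching y apart = agreeing d (λ k i → domPart false k ⟦ y i ⟧) K₁ K₂-large λ (g , h) →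
      no-rectangle (y ∘ g) (λ i j n → apart _ _ (proj₁ (h i j n))) (agree g h)
      where
      agree : (g : Fin K₁ → Fin K₂) → (∀ i j → i ≢ j → g i ≢ g j × AgreeOn (λ k i → domPart false k ⟦ y i ⟧) (g i) (g j)) →
        ∀ i j k → domPart false k ⟦ y (g i) ⟧ → domPart false k ⟦ y (g j) ⟧
      agree g h i j k with i ≟ᶠ j
      ... | yes refl = id
      ... | no n     = proj₁ (proj₂ (h i j n) k)

    Star : Bool → ℕ → Set
    Star b n = Σ (Fin n → X) λ x → (∀ i j → i ≢ j → ¬ Alike b (x i) (x j)) × (∀ i j → Alike (not b) (x i) (x j))

    -- If no large subfamily agreed on the side `not b`, there would be `K₂` vertices differing
    -- there as well as on side `b`, which is a matching.
    star : ∀ b {m} n → K₂ * n ≤ m → Distinct b m → ¬ ¬ Star b n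
    star b {m} n large (x , apart) r =
      dichotomy {R = λ i j → Alike (not b) (x i) (x j)} sameOn-sym sameOn-trans K₂ n large λ
        { (inj₁ (g , h)) → no-matching (x ∘ g) λ i j m →
            both b (apart _ _ (proj₁ (h i j m))) (proj₂ (h i j m))
        ; (inj₂ (g , h)) → r (x ∘ g , (λ i j m → apart _ _ (proj₁ (h i j m))) , alike g h) }
      where
      both : ∀ b {U V} → ¬ SameOn χ b U V → ¬ SameOn χ (not b) U V → ∀ b′ → ¬ SameOn χ b′ U V
      both false p q false = p
      both false p q true  = q
      both true  p q false = q
      both true  p q true  = p
      alike : (g : Fin n → Fin m) → (∀ i j → i ≢ j → g i ≢ g j × Alike (not b) (x (g i)) (x (g j))) →
        ∀ i j → Alike (not b) (x (g i)) (x (g j))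
      alike g h i j with i ≟ᶠ j
      ... | yes refl = sameOn-refl
      ... | no m     = proj₂ (h i j m)

    -- At most one member of a star is like `z` on side `b`, so dropping one member suffices.
    avoid : ∀ {b n} (z : X) → Star b (suc n) → ¬ ¬ (Σ (Star b n) λ (x , _) → ∀ i → ¬ Alike b (x i) z)
    avoid {b} {n} z (x , apart , alike) r = ¬¬-excluded-middle {A = ∃ λ i → Alike b (x i) z} λ
      { (yes (i , s)) → r (sub (punchIn i) (punchIn-injective i) , λ j s′ →
          apart _ _ (punchInᵢ≢i i j) (sameOn-trans s′ (sameOn-sym s)))
      ; (no ¬s)       → r (sub suc (λ _ _ → suc-injective) , λ j s → ¬s (suc j , s)) }
      where
      sub : (g : Fin n → Fin (suc n)) → (∀ i j → g i ≡ g j → i ≡ j) → Star b n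
      sub g g-inj = x ∘ g , (λ i j m → apart _ _ (m ∘ g-inj i j)) , λ i j → alike _ _

    -- Vertices y s adjacent to a s and b s only form, once their types over the
    -- centres of the two stars agree, a matching.
    no-two-stars : ((a , _) : Star false (suc T)) ((b , _) : Star true (suc T)) → (∀ i j → ¬ Alike false (a i) (b j)) → ⊥
    no-two-stars (a , a-apart , a-alike) (b , b-apart , b-alike) ab-apart =
      agreeing c (λ k s → edgePart true k ⟦ y s ⟧ ⟦ a zero ⟧) (suc (2 ^ c) * K₂) T-large λ (g , h) →
      agreeing c (λ k s → edgePart false k ⟦ y (g s) ⟧ ⟦ b zero ⟧) K₂ ≤-refl λ (g′ , h′) →
      no-matching (y ∘ g ∘ g′) λ i j n →
        let (m′ , eqᵇ) = h′ i j n
            (m , eqᵃ)  = h _ _ m′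
            s = g (g′ i) ; r = g (g′ j)
        -- The `a`s look alike inside and the `b`s outside, so the equalised types over `a zero` and
        -- `b zero` settle those sides. If `y s` and `y r` were alike on the remaining side, `y r`
        -- would be adjacent to `a s` or to `b s`.
        in λ { false y~ → adj-transfer {y s} {a s} {y r} {a s}
                 (λ { false k → edgePart-inv false k y~ sameOn-refl
                    ; true  k → edgePart-inv true k sameOn-refl (a-alike zero s) ∘ proj₁ (eqᵃ k) ∘
                                edgePart-inv true k sameOn-refl (a-alike s zero) })
                 (proj₁ (y-adj s s zero) refl) (proj₂ (y-adj r s zero) m)
             ; true  y~ → adj-transfer {y s} {b s} {y r} {b s}
                 (λ { true  k → edgePart-inv true k y~ sameOn-refl
                    ; false k → edgePart-inv false k sameOn-refl (b-alike zero s) ∘ proj₁ (eqᵇ k) ∘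
                                edgePart-inv false k sameOn-refl (b-alike s zero) })
                 (proj₁ (y-adj s s (suc zero)) refl) (proj₂ (y-adj r s (suc zero)) m) }
      where
      ab : Fin (suc T) → Fin 2 → X
      ab s zero       = a s
      ab s (suc zero) = b s
      apart : ∀ s {i j i′ j′} → i ≡ s → i′ ≢ s → ¬ Same (ab i j) (ab i′ j′)
      apart s {j = zero}     {j′ = zero}     refl n e = a-apart _ _ (n ∘ sym) (same⇒alike e false)
      apart s {j = zero}     {j′ = suc zero} refl n e = ab-apart _ _ (same⇒alike e false)
      apart s {j = suc zero} {j′ = zero}     refl n e = ab-apart _ _ (sameOn-sym (same⇒alike e false))
      apart s {j = suc zero} {j′ = suc zero} refl n e = b-apart _ _ (n ∘ sym) (same⇒alike e true)
      chosen : ∀ s → Σ X λ y → ∀ i j → (i ≡ s → Adj y (ab i j)) × (i ≢ s → ¬ Adj y (ab i j))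
      chosen s = separate ab {λ i _ → i ≡ s} (λ i _ → i ≟ᶠ s) (λ {i} {j} {i′} {j′} → apart s {i} {j} {i′} {j′})
      y : Fin (suc T) → X
      y s = proj₁ (chosen s)
      y-adj : ∀ s i j → (i ≡ s → Adj (y s) (ab i j)) × (i ≢ s → ¬ Adj (y s) (ab i j))
      y-adj s = proj₂ (chosen s)

    -- All `b`s share their outside part, so keeping the `a`s away from `b zero` outside keeps them
    -- away from every `b`. Each star has one vertex to spare for this.
    one-sided : Distinct false N → Distinct true N → ⊥
    one-sided outs ins =
      star false (suc (suc T)) N-large outs λ as → star true (suc (suc T)) N-large ins λ (b , b-apart , b-alike) →
      avoid {n = suc T} (b zero) as λ (as′ , as′-apart) →
      no-two-stars as′ (b ∘ suc , (λ i j n → b-apart _ _ (n ∘ suc-injective)) , λ i j → b-alike _ _)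
        λ i j s → as′-apart i (sameOn-trans s (b-alike (suc j) zero))

  -- Descent along heavy nodes.

  -- A finite set is determined by its part outside `u`, its parts below the two children, and
  -- whether it contains `u`. If few variants of each existed, two of many distinct vertices would
  -- coincide.
  heavy-child : ∀ u → ¬ Distinct u false N → (∀ b → ¬ Distinct (u ++ [ b ]) true N) → ⊥
  heavy-child u heavy light with distinctVertices (N * (N * (N * 6)))
  ... | x , apart =
    dichotomy {R = λ i j → Alike u false (x i) (x j)} sameOn-sym sameOn-trans N (N * (N * 6)) ≤-refl λ
      { (inj₁ (g , h)) → heavy (x ∘ g , λ i j n → proj₂ (h i j n))
      ; (inj₂ (g , h)) → alikeIn false (N * 6) (x ∘ g) λ (g₁ , h₁) → alikeIn true 6 (x ∘ g ∘ g₁) λ (g₂ , h₂) →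
        -- Six is `suc (2 ^ 1) * 2`: enough for two vertices that agree on containing `u`.
        agreeing 1 (λ _ i → u ∈ ⟦ x (g (g₁ (g₂ i))) ⟧) 2 ≤-refl λ (g₃ , h₃) →
        let (n₃ , a₃) = h₃ zero (suc zero) (λ ())
            (n₂ , a₂) = h₂ _ _ n₃
            (n₁ , a₁) = h₁ _ _ n₂
            (n₀ , a₀) = h _ _ n₁
        in apart _ _ n₀ (alike⇒same u λ { false → a₀ ; true → below (a₃ zero) λ { false → a₁ ; true → a₂ } }) }
    where
    alikeIn : ∀ b K (y : Fin (N * K) → X) → ¬ ¬ Subfamily (λ i j → Alike (u ++ [ b ]) true (y i) (y j)) K
    alikeIn b K y r = dichotomy {R = λ i j → Alike (u ++ [ b ]) true (y i) (y j)} sameOn-sym sameOn-trans N K ≤-refl λ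
      { (inj₁ (g , h)) → light b (y ∘ g , λ i j n → proj₂ (h i j n))
      ; (inj₂ s)       → r s }
    below : ∀ {U V} → (u ∈ U → u ∈ V) × (u ∈ V → u ∈ U) → (∀ b → SameOn (inside (u ++ [ b ])) true U V) →
      SameOn (inside u) true U V
    below same s .at w e with inside-cases u w e
    ... | inj₁ refl     = same
    ... | inj₂ (b , e′) = at (s b) w e′

  -- Induction on the depth left below `u`. At zero no `z i` reaches into the subtree, so the `z i`
  -- already differ outside `u`. Otherwise some child admits `N` vertices differing inside it, and
  -- `one-sided` makes that child heavy.
  no-heavy : ∀ n u (z : Fin N → X) → (∀ i j → i ≢ j → ¬ Same (z i) (z j)) →
    (∀ i {w} → w ∈ ⟦ z i ⟧ → length w < length u + n) → ¬ Distinct u false N → ⊥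
  no-heavy zero u z apart short heavy = heavy (z , λ i j n a →
    apart i j n (alike⇒same u λ { false → a ; true → sameOn λ w e → outside i e , outside j e }))
    where
    outside : ∀ i {w} {A : Set} → inside u w ≡ true → w ∈ ⟦ z i ⟧ → A
    outside i e p = ⊥-elim (<⇒≱ (short i p)
      (≤-trans (≤-reflexive (+-identityʳ (length u))) (inside-length u _ e)))
  no-heavy (suc n) u z apart short heavy = heavy-child u heavy λ b ins →
    no-heavy n (u ++ [ b ]) z apart
      (λ i p → ≤-trans (short i p) (≤-reflexive (deeper b)))
      (λ outs → one-sided (u ++ [ b ]) outs ins)
    where
    deeper : ∀ b → length u + suc n ≡ length (u ++ [ b ]) + n
    deeper b = trans (sym (+-assoc (length u) 1 n)) (cong (_+ n) (sym (length-++ u)))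

  no-isomorphism : ⊥
  no-isomorphism with distinctVertices N
  ... | z , apart = no-heavy (suc depth) [] z apart
      (λ i p → s≤s (All-lookup (xs≤max 0 lengths) (∈-map⁺ length (∈-concat⁺′ p (∈-tabulate⁺ i)))))
      -- No word lies outside the root, so any two vertices agree there; `2 ≤ N` provides the two
      -- indices that this contradicts.
      (λ (x , outs) → let (_ , i≢j) = twoElements in outs _ _ i≢j (sameOn λ w ()))
    where
    twoElements : Σ (Fin N × Fin N) λ (i , j) → i ≢ j
    twoElements = (inject≤ zero 2≤N , inject≤ (suc zero) 2≤N) , λ e → case (inject≤-injective 2≤N 2≤N zero (suc zero) e) of λ ()
    lengths = map length (concat (tabulate (⟦_⟧ ∘ z)))
    depth = max 0 lengths

theorem5p4 : ∀ (k : ℕ) (t : Tree k) (I : FSInterp k) (G : Graph) →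
    IsRandomGraph G → ¬ IsoToGraph I t G
theorem5p4 k t I G (_ , extension) iso = no-isomorphism t I G extension iso
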